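{- Consider the canonical negative-positive double Boolean automata circuit $D_{\ell,r}$ (negative left-circuit of size $\ell$, positive right-circuit of size $r$). Let $p\in\mathbb{N}$ be a divisor of $r=p\cdot q$ that does not divide $\ell$, and write $\ell=k\cdot p+d$ with $d=\ell \bmod p$. A configuration $x=x(t)$ has period $p$ if and only if there exists a circular word $w\in\{0,1\}^p$ of size $p$ that does not contain the sub-sequence $0u0$, $u\in\{0,1\}^{d-1}$, and that satisfies $$x^L = w^k\,w[0\ldots d-1]\qquad\text{and}\qquad x^R=w^q ,$$ where $w[0\ldots m]=w_0\ldots w_m$. More precisely, the word $w$ satisfies $$\forall i<p,\quad w_i=x_0(t+i).$$ Consequently, the property for a configuration to be of period $p$ depends only on $d=\ell\bmod p$ and on $p$ (and not on $\ell$ nor on $r$).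
   Context: The canonical negative-positive double Boolean automata circuit $D_{\ell,r}$ has $n=\ell+r-1$ nodes $0,\ldots,n-1$. For a configuration $x=(x_0,\ldots,x_{n-1})\in\{0,1\}^n$ write $x^L=(x_0,\ldots,x_{\ell-1})$ (states of the left-circuit) and $x^R=(x_0,x_\ell,\ldots,x_{n-1})$ (states of the right-circuit, $r$ entries). All nodes are updated in parallel by $F:\{0,1\}^n\to\{0,1\}^n$: $F(x)_i=x_{i-1}$ for $i\notin\{0,\ell\}$; $F(x)_\ell=x_0$; and $F(x)_0=\neg x_{\ell-1}\vee x_{n-1}$. A trajectory is given by $x(t+1)=F(x(t))$, and $x_0(t+i)$ denotes the state of node $0$ in $x(t+i)=F^i(x(t))$. A configuration $x(t)$ has period $p$ if $x(t+m\cdot p)=x(t)$ for all $m\in\mathbb{N}$; $p$ need not be minimal. For a word $w$, $w^k$ is the $k$-fold concatenation of $w$. A circular word $w=w_0\ldots w_{p-1}$ contains $0u0$ for some $u\in\{0,1\}^{d-1}$ iff there is an index $i$ with $w_i=w_{(i+d)\bmod p}=0$.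
   Formalization: The clause w_i = x_0(t+i) is false as stated (ℓ=1, r=p=3, x=(1,1,0): w=110 but x_0(t), x_0(t+1), x_0(t+2) = 1,0,1); it is replaced by w_{(-i) mod p} = x_0(t+i) for all i<p, since w lists the past states of node 0. -}

module Defs where

open import Data.Bool using (Bool; true; false; not; _∨_)
open import Data.Fin as Fin using (Fin; toℕ; fromℕ<)
open import Data.List as List using (List; _∷_; _++_; concat; replicate; take; drop)
open import Data.Nat using (ℕ; zero; suc; _+_; _*_; _∸_; _<_; s≤s; z≤n; NonZero)
open import Data.Nat.DivMod using (_mod_)
open import Data.Nat.GeneralisedArithmetic using (iterate)
open import Data.Nat.Properties using (_≟_; m≤m+n; ≤-refl; +-suc)
open import Data.Product using (∃; _×_; _,_)
open import Data.Vec using (Vec; []; _∷_; lookup; tabulate; toList)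
open import Relation.Binary.PropositionalEquality using (_≡_; refl; subst; sym)
open import Relation.Nullary using (¬_; yes; no)

-- 1 is `true`, 0 is `false`.
Word : ℕ → Set
Word = Vec Bool

_^ʷ_ : List Bool → ℕ → List Bool
w ^ʷ k = concat (replicate k w)

Contains0u0 : ∀ {p} .{{_ : NonZero p}} → ℕ → Word p → Set
Contains0u0 {p} d w = ∃ λ (i : Fin p) →
  lookup w i ≡ false × lookup w ((toℕ i + d) mod p) ≡ false

Config : ℕ → ℕ → Set
Config ℓ r = Vec Bool (ℓ + r ∸ 1)

module Circuit (ℓ r : ℕ) .{{_ : NonZero ℓ}} .{{_ : NonZero r}} where

  private
    0<n : ∀ a b .{{_ : NonZero a}} .{{_ : NonZero b}} → 0 < a + b ∸ 1
    0<n (suc a) (suc b) = subst (0 <_) (sym (+-suc a b)) (s≤s z≤n)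

    ℓ-1<n : ∀ a b .{{_ : NonZero a}} .{{_ : NonZero b}} → a ∸ 1 < a + b ∸ 1
    ℓ-1<n (suc a) (suc b) = subst (a <_) (sym (+-suc a b)) (s≤s (m≤m+n a b))

    n-1<n : ∀ {m} → 0 < m → m ∸ 1 < m
    n-1<n (s≤s _) = ≤-refl

  node₀ : Fin (ℓ + r ∸ 1)
  node₀ = fromℕ< (0<n ℓ r)

  lastˡ : Fin (ℓ + r ∸ 1)
  lastˡ = fromℕ< (ℓ-1<n ℓ r)

  -- Node n-1 with n = ℓ + r - 1.
  lastʳ : Fin (ℓ + r ∸ 1)
  lastʳ = fromℕ< (n-1<n (0<n ℓ r))

  update : Config ℓ r → Fin (ℓ + r ∸ 1) → Bool
  update x i with toℕ i ≟ 0 | toℕ i ≟ ℓ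
  ... | yes _ | _     = not (lookup x lastˡ) ∨ lookup x lastʳ
  ... | no  _ | yes _ = lookup x node₀
  ... | no  _ | no  _ = lookup x (Fin.pred i)

  F : Config ℓ r → Config ℓ r
  F x = tabulate (update x)

  -- When x = x(t), this is x₀(t + i).
  state₀ : Config ℓ r → ℕ → Bool
  state₀ x i = lookup (iterate F x i) node₀

  -- p is a period, not necessarily the least one.
  HasPeriod : ℕ → Config ℓ r → Set
  HasPeriod p x = ∀ m → iterate F x (m * p) ≡ x

  leftWord : Config ℓ r → List Bool
  leftWord x = take ℓ (toList x)

  rightWord : Config ℓ r → List Bool
  rightWord x = lookup x node₀ ∷ drop ℓ (toList x)

  -- x^L = w^k w[0…d-1]  and  x^R = w^q.
  Spells : ∀ {p} → (k q d : ℕ) → Word p → Config ℓ r → Set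
  Spells k q d w x =
      leftWord x  ≡ (toList w ^ʷ k) ++ take d (toList w)
    × rightWord x ≡ toList w ^ʷ q

  -- w₋ᵢ = x₀(t + i) for all i < p, the index of the circular word w being
  -- taken modulo p.  The sign is forced: states travel towards increasing node
  -- numbers, so that node i of either circuit carries x₀(t - i), and x^R = w^q
  -- then makes w list the past states of node 0.  The variant wᵢ = x₀(t + i)
  -- is refuted by `unmirrored-fails` below.
  TracesNode₀ : ∀ {p} .{{_ : NonZero p}} → Word p → Config ℓ r → Set
  TracesNode₀ {p} w x =
    ∀ (i : Fin p) → lookup w ((p ∸ toℕ i) mod p) ≡ state₀ x (toℕ i)

open Circuit public

-- ℓ = 1, r = p = 3, hence k = 0, q = 1, d = 1.
unmirrored-fails : ∃ λ (x : Config 1 3) → ∃ λ (w : Word 3) →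
    HasPeriod 1 3 3 x × ¬ Contains0u0 1 w × Spells 1 3 0 1 1 w x
  × TracesNode₀ 1 3 w x
  × ¬ (∀ (i : Fin 3) → lookup w i ≡ state₀ 1 3 x (toℕ i))
unmirrored-fails = c , c , period , avoids , (refl , refl) , traces , fails
  where
  c : Vec Bool 3
  c = true ∷ true ∷ false ∷ []
  period : HasPeriod 1 3 3 c
  period zero    = refl
  period (suc m) = period m
  avoids : ¬ Contains0u0 1 c
  avoids (Fin.suc (Fin.suc Fin.zero) , _ , ())
  traces : TracesNode₀ 1 3 c c
  traces Fin.zero                   = refl
  traces (Fin.suc Fin.zero)           = refl
  traces (Fin.suc (Fin.suc Fin.zero)) = refl
  fails : ¬ (∀ (i : Fin 3) → lookup c i ≡ state₀ 1 3 c (toℕ i))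
  fails h with h (Fin.suc Fin.zero)
  ... | ()

{-# OPTIONS --safe #-}
module Submission where

-- In either circuit a state moves one node further at each step, so a node at
-- distance a from node 0 carries the state that node 0 had a steps ago: once
-- the past of node 0 is known, as a sequence g with g a = x₀(t − a), the
-- configuration is determined.  If x has period p, so has g, and g restricted
-- to one period is the word w.  Since r ≡ 0 and ℓ ≡ d modulo p, the update rule
-- of node 0 becomes g a = ¬ g (a + d) ∨ g a, which says precisely that g a and
-- g (a + d) are never both 0.

open import Defs
open import Data.Bool using (Bool; true; false; not; _∨_)
open import Data.Bool.Properties using (∨-zeroʳ)
open import Data.Fin as Fin using (Fin; toℕ)
open import Data.Fin.Properties using (toℕ-fromℕ<; toℕ-inject₁; toℕ-injective; toℕ<n)
open import Data.List using (List; []; _∷_; _++_; applyUpTo; drop; length; take)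
open import Data.List.Properties using (++-assoc; ++-identityʳ; length-applyUpTo; take++drop≡id; ∷-injective; ∷-injectiveʳ)
open import Data.Nat using (ℕ; zero; suc; pred; _+_; _*_; _∸_; _≤_; _<_; _<?_; s≤s; z≤n; >-nonZero⁻¹; NonZero)
open import Data.Nat.DivMod using (_%_; _/_; _mod_; m%n<n; m<n⇒m%n≡m; [m+n]%n≡m%n; m≡m%n+[m/n]*n)
open import Data.Nat.Divisibility using (_∣_; 1∣_; ∣⇒≤; m∣m*n)
open import Data.Nat.GeneralisedArithmetic using (iterate)
open import Data.Nat.Properties using (_≟_; ≤-trans; <⇒≤; ≮⇒≥; n<1+n; ≤∧≢⇒<; 1+n≢0; 0≢1+n; suc-pred; suc-injective; +-∸-assoc; +-assoc; +-comm; +-suc; +-identityʳ; *-comm; *-suc; *-assoc; *-distribʳ-+; m+n∸m≡n; m+n≮m; m+[n∸m]≡n; m∸n+n≡m)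
open import Data.Product using (∃; _×_; _,_)
open import Data.Vec using (Vec; []; _∷_; lookup; tabulate; toList)
open import Data.Vec.Properties using (lookup∘tabulate; tabulate∘lookup; tabulate-cong; cast-is-id; toList-injective)
open import Function using (_∘_)
open import Function.Bundles using (_⇔_; mk⇔)
open import Relation.Binary.PropositionalEquality using (_≡_; _≢_; refl; sym; trans; cong; cong₂; subst; module ≡-Reasoning)
open import Relation.Nullary using (¬_; Dec; yes; no; contradiction)

open ≡-Reasoning

private
  variable
    A : Set

-- Iterates of a map, and initial segments of lists and sequences.

iterate-+ : ∀ (f : A → A) x m n → iterate f x (m + n) ≡ iterate f (iterate f x m) n
iterate-+ f x zero    n = refl
iterate-+ f x (suc m) n = iterate-+ f (f x) m n

iterate-suc : ∀ (f : A → A) x n → iterate f x (suc n) ≡ f (iterate f x n)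
iterate-suc f x zero    = refl
iterate-suc f x (suc n) = iterate-suc f (f x) n

take-length-++ : ∀ (xs ys : List A) → take (length xs) (xs ++ ys) ≡ xs
take-length-++ []       ys = refl
take-length-++ (x ∷ xs) ys = cong (x ∷_) (take-length-++ xs ys)

drop-length-++ : ∀ (xs ys : List A) → drop (length xs) (xs ++ ys) ≡ ys
drop-length-++ []       ys = refl
drop-length-++ (x ∷ xs) ys = drop-length-++ xs ys

take-drop-injective : ∀ n {xs ys : List A} → take n xs ≡ take n ys → drop n xs ≡ drop n ys → xs ≡ ys
take-drop-injective n {xs} {ys} eq eq′ =
  trans (sym (take++drop≡id n xs)) (trans (cong₂ _++_ eq eq′) (take++drop≡id n ys))

applyUpTo-cong : ∀ {f g : ℕ → A} n → (∀ {j} → j < n → f j ≡ g j) → applyUpTo f n ≡ applyUpTo g n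
applyUpTo-cong zero    f≗g = refl
applyUpTo-cong (suc n) f≗g = cong₂ _∷_ (f≗g (s≤s z≤n)) (applyUpTo-cong n (λ j<n → f≗g (s≤s j<n)))

applyUpTo-+ : ∀ (f : ℕ → A) m n → applyUpTo f (m + n) ≡ applyUpTo f m ++ applyUpTo (λ j → f (m + j)) n
applyUpTo-+ f zero    n = refl
applyUpTo-+ f (suc m) n = cong (f 0 ∷_) (applyUpTo-+ (f ∘ suc) m n)

take-applyUpTo-++ : ∀ (f : ℕ → A) n ys → take n (applyUpTo f n ++ ys) ≡ applyUpTo f n
take-applyUpTo-++ f n ys =
  subst (λ m → take m (applyUpTo f n ++ ys) ≡ applyUpTo f n) (length-applyUpTo f n)
    (take-length-++ (applyUpTo f n) ys)

drop-applyUpTo-++ : ∀ (f : ℕ → A) n ys → drop n (applyUpTo f n ++ ys) ≡ ys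
drop-applyUpTo-++ f n ys =
  subst (λ m → drop m (applyUpTo f n ++ ys) ≡ ys) (length-applyUpTo f n)
    (drop-length-++ (applyUpTo f n) ys)

take-applyUpTo : ∀ (f : ℕ → A) {m n} → m ≤ n → take m (applyUpTo f n) ≡ applyUpTo f m
take-applyUpTo f {m} {n} m≤n = begin
  take m (applyUpTo f n)             ≡⟨ cong (take m ∘ applyUpTo f) (m+[n∸m]≡n m≤n) ⟨
  take m (applyUpTo f (m + (n ∸ m))) ≡⟨ cong (take m) (applyUpTo-+ f m (n ∸ m)) ⟩
  take m (applyUpTo f m ++ _)        ≡⟨ take-applyUpTo-++ f m _ ⟩
  applyUpTo f m                      ∎

toList-tabulate : ∀ (f : ℕ → A) n → toList (tabulate {n = n} (f ∘ toℕ)) ≡ applyUpTo f n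
toList-tabulate f zero    = refl
toList-tabulate f (suc n) = cong (f 0 ∷_) (toList-tabulate (f ∘ suc) n)

-- The common length n aligns the two prefixes, whatever follows them.
toList-++-injectiveˡ : ∀ {n} (u v : Vec A n) {xs ys} → toList u ++ xs ≡ toList v ++ ys → u ≡ v
toList-++-injectiveˡ []      []      eq = refl
toList-++-injectiveˡ (a ∷ u) (b ∷ v) eq with ∷-injective eq
... | a≡b , eq′ = cong₂ _∷_ a≡b (toList-++-injectiveˡ u v eq′)

-- Periodic sequences and circular words

Periodic : ℕ → (ℕ → A) → Set
Periodic p g = ∀ j → g (j + p) ≡ g j

-- The condition on 0u0 for an infinite sequence, where the index j + d needs no reduction modulo p.
Avoids : ℕ → (ℕ → Bool) → Set
Avoids d g = ∀ j → g j ≡ false → g (j + d) ≢ false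

module _ {p : ℕ} {g : ℕ → A} (per : Periodic p g) where

  periodic-* : ∀ m j → g (j + m * p) ≡ g j
  periodic-* zero    j = cong g (+-identityʳ j)
  periodic-* (suc m) j = begin
    g (j + (p + m * p)) ≡⟨ cong g (+-assoc j p (m * p)) ⟨
    g (j + p + m * p)   ≡⟨ periodic-* m (j + p) ⟩
    g (j + p)           ≡⟨ per j ⟩
    g j                 ∎

  -- Congruence of i and j modulo p, witnessed by multiples of p on both sides so that no
  -- subtraction occurs.
  periodic-≡ : ∀ {i j} m n → i + m * p ≡ j + n * p → g i ≡ g j
  periodic-≡ {i} {j} m n eq = begin
    g i           ≡⟨ periodic-* m i ⟨
    g (i + m * p) ≡⟨ cong g eq ⟩
    g (j + n * p) ≡⟨ periodic-* n j ⟩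
    g j           ∎

  periodic-% : .{{_ : NonZero p}} → ∀ j → g (j % p) ≡ g j
  periodic-% j = sym (trans (cong g (m≡m%n+[m/n]*n j p)) (periodic-* (j / p) (j % p)))

-- Splitting off the first period leaves the sequence shifted by p, which is g again.
applyUpTo-periodic : ∀ {p} {g : ℕ → Bool} → Periodic p g → ∀ k n →
  (applyUpTo g p ^ʷ k) ++ applyUpTo g n ≡ applyUpTo g (k * p + n)
applyUpTo-periodic         per zero    n = refl
applyUpTo-periodic {p} {g} per (suc k) n = begin
  (applyUpTo g p ++ (applyUpTo g p ^ʷ k)) ++ applyUpTo g n
    ≡⟨ ++-assoc (applyUpTo g p) _ _ ⟩
  applyUpTo g p ++ ((applyUpTo g p ^ʷ k) ++ applyUpTo g n)
    ≡⟨ cong (applyUpTo g p ++_) (applyUpTo-periodic per k n) ⟩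
  applyUpTo g p ++ applyUpTo g (k * p + n)
    ≡⟨ cong (applyUpTo g p ++_)
         (applyUpTo-cong (k * p + n) (λ {j} _ → trans (cong g (+-comm p j)) (per j))) ⟨
  applyUpTo g p ++ applyUpTo (λ j → g (p + j)) (k * p + n)
    ≡⟨ applyUpTo-+ g p (k * p + n) ⟨
  applyUpTo g (p + (k * p + n))
    ≡⟨ cong (applyUpTo g) (+-assoc p (k * p) n) ⟨
  applyUpTo g (p + k * p + n) ∎

-- If g j is 1, both sides are 1. If g j is 0, the right side is the negation of g (j + d), which is
-- 0 exactly when the second zero is avoided.
avoids⇒fixed : ∀ {d g} → Avoids d g → ∀ j → g j ≡ not (g (j + d)) ∨ g j
avoids⇒fixed {d} {g} av j with g j in eq
... | true  = sym (∨-zeroʳ _)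
... | false with g (j + d) in eq′
...   | true  = refl
...   | false = contradiction eq′ (av j eq)

fixed⇒avoids : ∀ {d g} → (∀ j → g j ≡ not (g (j + d)) ∨ g j) → Avoids d g
fixed⇒avoids {g = g} fixed j eq eq′ =
  contradiction (trans (sym eq) (trans (fixed j) (cong (λ b → not b ∨ g j) eq′))) λ ()

module _ {p : ℕ} .{{_ : NonZero p}} where

  cycle : Word p → ℕ → Bool
  cycle w j = lookup w (j mod p)

  mod-cong : ∀ {i j} → i % p ≡ j % p → i mod p ≡ j mod p
  mod-cong {i} {j} eq = toℕ-injective
    (trans (toℕ-fromℕ< (m%n<n i p)) (trans eq (sym (toℕ-fromℕ< (m%n<n j p)))))

  cycle-periodic : ∀ w → Periodic p (cycle w)
  cycle-periodic w j = cong (lookup w) (mod-cong ([m+n]%n≡m%n j p))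

  cycle-toℕ : ∀ w (i : Fin p) → cycle w (toℕ i) ≡ lookup w i
  cycle-toℕ w i = cong (lookup w) (toℕ-injective
    (trans (toℕ-fromℕ< (m%n<n (toℕ i) p)) (m<n⇒m%n≡m (toℕ<n i))))

  toList-cycle : ∀ w → toList w ≡ applyUpTo (cycle w) p
  toList-cycle w = begin
    toList w                             ≡⟨ cong toList (tabulate∘lookup w) ⟨
    toList (tabulate (lookup w))         ≡⟨ cong toList (tabulate-cong (cycle-toℕ w)) ⟨
    toList (tabulate (cycle w ∘ toℕ))    ≡⟨ toList-tabulate (cycle w) p ⟩
    applyUpTo (cycle w) p                ∎

  onePeriod : (ℕ → Bool) → Word p
  onePeriod g = tabulate (g ∘ toℕ)

  cycle-onePeriod : ∀ {g} → Periodic p g → ∀ j → cycle (onePeriod g) j ≡ g j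
  cycle-onePeriod {g} per j = begin
    lookup (onePeriod g) (j mod p) ≡⟨ lookup∘tabulate (g ∘ toℕ) (j mod p) ⟩
    g (toℕ (j mod p))              ≡⟨ cong g (toℕ-fromℕ< (m%n<n j p)) ⟩
    g (j % p)                      ≡⟨ periodic-% per j ⟩
    g j                            ∎

  avoids⇒¬contains : ∀ {d} w → Avoids d (cycle w) → ¬ Contains0u0 d w
  avoids⇒¬contains w av (i , wᵢ≡0 , wᵢ₊d≡0) = av (toℕ i) (trans (cycle-toℕ w i) wᵢ≡0) wᵢ₊d≡0

  -- Zeros at j and j + d can be moved back together until the first lies in the initial period,
  -- because the sequence shifted by d is p-periodic too.
  ¬contains⇒avoids : ∀ {d} w → ¬ Contains0u0 d w → Avoids d (cycle w)
  ¬contains⇒avoids {d} w nc j wⱼ≡0 wⱼ₊d≡0 = nc (j mod p , wⱼ≡0 , (begin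
    cycle w (toℕ (j mod p) + d) ≡⟨ cong (λ i → cycle w (i + d)) (toℕ-fromℕ< (m%n<n j p)) ⟩
    cycle w (j % p + d)         ≡⟨ periodic-% shifted j ⟩
    cycle w (j + d)             ≡⟨ wⱼ₊d≡0 ⟩
    false                       ∎))
    where
    shifted : Periodic p (λ i → cycle w (i + d))
    shifted i = trans (cong (cycle w) (trans (+-assoc i p d) (trans (cong (i +_) (+-comm p d)) (sym (+-assoc i d p)))))
                      (cycle-periodic w (i + d))

-- Configurations as histories of node 0

module History (ℓ r : ℕ) .{{ℓ≢0 : NonZero ℓ}} .{{r≢0 : NonZero r}} where

  -- The distance from node 0: a state of node 0 takes this many steps to reach the node.
  age : ℕ → ℕ
  age j with j <? ℓ
  ... | yes _ = j
  ... | no  _ = suc (j ∸ ℓ)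

  age-left : ∀ {j} → j < ℓ → age j ≡ j
  age-left {j} j<ℓ with j <? ℓ
  ... | yes _   = refl
  ... | no  j≮ℓ = contradiction j<ℓ j≮ℓ

  age-right : ∀ j → age (ℓ + j) ≡ suc j
  age-right j with ℓ + j <? ℓ
  ... | yes ℓ+j<ℓ = contradiction ℓ+j<ℓ (m+n≮m ℓ j)
  ... | no  _     = cong suc (m+n∸m≡n ℓ j)

  -- Position ℓ is excluded because there the numbering passes from the end of the left-circuit to
  -- the successor of node 0 in the right-circuit, where the age restarts at 1.
  age-suc : ∀ j → suc j ≢ ℓ → age (suc j) ≡ suc (age j)
  age-suc j j≢ℓ with suc j <? ℓ | j <? ℓ
  ... | yes _    | yes _   = refl
  ... | yes j+1< | no  j≮ℓ = contradiction (<⇒≤ j+1<) j≮ℓ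
  ... | no  j+1≮ | yes j<ℓ = contradiction (≤∧≢⇒< j<ℓ j≢ℓ) j+1≮
  ... | no  _    | no  j≮ℓ = cong suc (+-∸-assoc 1 (≮⇒≥ j≮ℓ))

  age-0 : age 0 ≡ 0
  age-0 = age-left (>-nonZero⁻¹ ℓ)

  node-age : Fin (ℓ + r ∸ 1) → ℕ
  node-age i = age (toℕ i)

  toℕ-node₀ : toℕ (node₀ ℓ r) ≡ 0
  toℕ-node₀ = toℕ-fromℕ< _

  age-node₀ : node-age (node₀ ℓ r) ≡ 0
  age-node₀ = trans (cong age toℕ-node₀) age-0

  age-lastˡ : node-age (lastˡ ℓ r) ≡ pred ℓ
  age-lastˡ = trans (cong age (toℕ-fromℕ< _)) (age-left (subst (pred ℓ <_) (suc-pred ℓ) (n<1+n (pred ℓ))))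

  -- For r = 1 the node n - 1 would be ℓ - 1, a node of the left-circuit with age ℓ - 1.
  age-lastʳ : 1 < r → node-age (lastʳ ℓ r) ≡ pred r
  age-lastʳ 1<r = trans (cong age (trans (toℕ-fromℕ< _) (lemma 1<r))) (trans (age-right (r ∸ 2)) (lemma′ 1<r))
    where
    lemma : ∀ {s} → 1 < s → ℓ + s ∸ 1 ∸ 1 ≡ ℓ + (s ∸ 2)
    lemma {suc (suc b)} _ = cong (λ n → n ∸ 1 ∸ 1) (trans (+-suc ℓ (suc b)) (cong suc (+-suc ℓ b)))
    lemma {suc zero} (s≤s ())
    lemma′ : ∀ {s} → 1 < s → suc (s ∸ 2) ≡ pred s
    lemma′ {suc (suc b)} _ = refl
    lemma′ {suc zero} (s≤s ())

  -- The three cases of `update` become two: node 0 computes, and every other node copies a node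
  -- that is younger by one. Later arguments then refer to ages only and no longer to node numbers.
  data Source (i : Fin (ℓ + r ∸ 1)) : Set where
    origin : i ≡ node₀ ℓ r →
             (∀ x → update ℓ r x i ≡ not (lookup x (lastˡ ℓ r)) ∨ lookup x (lastʳ ℓ r)) → Source i
    copy   : ∀ j → node-age i ≡ suc (node-age j) → (∀ x → update ℓ r x i ≡ lookup x j) → Source i

  toℕ-pred : ∀ {n} (i : Fin n) → toℕ i ≢ 0 → suc (toℕ (Fin.pred i)) ≡ toℕ i
  toℕ-pred Fin.zero    i≢0 = contradiction refl i≢0
  toℕ-pred (Fin.suc i) _   = cong suc (toℕ-inject₁ i)

  update-origin : ∀ x i → toℕ i ≡ 0 → update ℓ r x i ≡ not (lookup x (lastˡ ℓ r)) ∨ lookup x (lastʳ ℓ r)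
  update-origin x i i≡0 with toℕ i ≟ 0 | toℕ i ≟ ℓ
  ... | yes _   | _ = refl
  ... | no  i≢0 | _ = contradiction i≡0 i≢0

  update-ℓ : ∀ x i → toℕ i ≢ 0 → toℕ i ≡ ℓ → update ℓ r x i ≡ lookup x (node₀ ℓ r)
  update-ℓ x i i≢0 i≡ℓ with toℕ i ≟ 0 | toℕ i ≟ ℓ
  ... | yes i≡0 | _       = contradiction i≡0 i≢0
  ... | no  _   | yes _   = refl
  ... | no  _   | no  i≢ℓ = contradiction i≡ℓ i≢ℓ

  update-pred : ∀ x i → toℕ i ≢ 0 → toℕ i ≢ ℓ → update ℓ r x i ≡ lookup x (Fin.pred i)
  update-pred x i i≢0 i≢ℓ with toℕ i ≟ 0 | toℕ i ≟ ℓ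
  ... | yes i≡0 | _       = contradiction i≡0 i≢0
  ... | no  _   | yes i≡ℓ = contradiction i≡ℓ i≢ℓ
  ... | no  _   | no  _   = refl

  source : ∀ i → Source i
  source i = go (toℕ i ≟ 0) (toℕ i ≟ ℓ)
    where
    go : Dec (toℕ i ≡ 0) → Dec (toℕ i ≡ ℓ) → Source i
    go (yes i≡0) _         = origin (toℕ-injective (trans i≡0 (sym toℕ-node₀))) λ x → update-origin x i i≡0
    go (no  i≢0) (yes i≡ℓ) = copy (node₀ ℓ r) age≡ λ x → update-ℓ x i i≢0 i≡ℓ
      where
      age≡ : node-age i ≡ suc (node-age (node₀ ℓ r))
      age≡ = begin
        age (toℕ i)                ≡⟨ cong age (trans i≡ℓ (sym (+-identityʳ ℓ))) ⟩
        age (ℓ + 0)                ≡⟨ age-right 0 ⟩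
        1                          ≡⟨ cong suc age-node₀ ⟨
        suc (node-age (node₀ ℓ r)) ∎
    go (no  i≢0) (no  i≢ℓ) = copy (Fin.pred i) age≡ λ x → update-pred x i i≢0 i≢ℓ
      where
      1+pred : suc (toℕ (Fin.pred i)) ≡ toℕ i
      1+pred = toℕ-pred i i≢0
      age≡ : node-age i ≡ suc (node-age (Fin.pred i))
      age≡ = trans (cong age (sym 1+pred)) (age-suc (toℕ (Fin.pred i)) (i≢ℓ ∘ trans (sym 1+pred)))

  lookup-F : ∀ x i → lookup (F ℓ r x) i ≡ update ℓ r x i
  lookup-F x i = lookup∘tabulate (update ℓ r x) i

  -- Following the copies backwards lowers both the time and the age by one, so the chain reaches
  -- node 0 exactly at the configuration y.
  lookup-delayed : ∀ y i → lookup (iterate (F ℓ r) y (node-age i)) i ≡ lookup y (node₀ ℓ r)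
  lookup-delayed y i = go (node-age i) i refl
    where
    go : ∀ m i → node-age i ≡ m → lookup (iterate (F ℓ r) y m) i ≡ lookup y (node₀ ℓ r)
    go m i age≡m with source i
    go zero    i age≡m | origin refl _   = refl
    go (suc m) i age≡m | origin refl _   = contradiction (trans (sym age-node₀) age≡m) 0≢1+n
    go zero    i age≡m | copy j age≡ upd = contradiction (trans (sym age≡) age≡m) 1+n≢0
    go (suc m) i age≡m | copy j age≡ upd = begin
      lookup (iterate (F ℓ r) y (suc m)) i   ≡⟨ cong (λ z → lookup z i) (iterate-suc (F ℓ r) y m) ⟩
      lookup (F ℓ r (iterate (F ℓ r) y m)) i ≡⟨ lookup-F _ i ⟩
      update ℓ r (iterate (F ℓ r) y m) i     ≡⟨ upd _ ⟩
      lookup (iterate (F ℓ r) y m) j         ≡⟨ go m j (suc-injective (trans (sym age≡) age≡m)) ⟩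
      lookup y (node₀ ℓ r)                   ∎

  -- The value g a stands for x₀(t - a); values at ages that no node has are ignored.
  fromHistory : (ℕ → Bool) → Config ℓ r
  fromHistory g = tabulate (λ i → g (node-age i))

  lookup-fromHistory : ∀ g i {a} → node-age i ≡ a → lookup (fromHistory g) i ≡ g a
  lookup-fromHistory g i refl = lookup∘tabulate (λ i → g (node-age i)) i

  fromHistory-cong : ∀ {g h} → (∀ j → g j ≡ h j) → fromHistory g ≡ fromHistory h
  fromHistory-cong g≗h = tabulate-cong (λ i → g≗h (node-age i))

  update-node₀ : ∀ x → lookup (F ℓ r x) (node₀ ℓ r) ≡ not (lookup x (lastˡ ℓ r)) ∨ lookup x (lastʳ ℓ r)
  update-node₀ x with source (node₀ ℓ r)
  ... | origin _ upd    = trans (lookup-F x (node₀ ℓ r)) (upd x)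
  ... | copy j age≡ _   = contradiction (trans (sym age-node₀) age≡) 0≢1+n

  state₀-+ : ∀ x s t → state₀ ℓ r (iterate (F ℓ r) x s) t ≡ state₀ ℓ r x (s + t)
  state₀-+ x s t = cong (λ y → lookup y (node₀ ℓ r)) (sym (iterate-+ (F ℓ r) x s t))

  state₀-suc : ∀ x t → state₀ ℓ r x (suc t) ≡ lookup (F ℓ r (iterate (F ℓ r) x t)) (node₀ ℓ r)
  state₀-suc x t = cong (λ y → lookup y (node₀ ℓ r)) (iterate-suc (F ℓ r) x t)

  -- Here h is the history one step later: its value at 0 is the newly computed state, and every
  -- state of g has become older by one.
  F-fromHistory : 1 < r → ∀ {g h} → h 0 ≡ not (g (pred ℓ)) ∨ g (pred r) → (∀ j → h (suc j) ≡ g j) →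
                  F ℓ r (fromHistory g) ≡ fromHistory h
  F-fromHistory 1<r {g} {h} h0 hs = tabulate-cong step
    where
    step : ∀ i → update ℓ r (fromHistory g) i ≡ h (node-age i)
    step i with source i
    ... | origin refl upd = begin
      update ℓ r (fromHistory g) (node₀ ℓ r) ≡⟨ upd _ ⟩
      not (lookup (fromHistory g) (lastˡ ℓ r)) ∨ lookup (fromHistory g) (lastʳ ℓ r)
        ≡⟨ cong₂ (λ a b → not a ∨ b) (lookup-fromHistory g (lastˡ ℓ r) age-lastˡ)
                                      (lookup-fromHistory g (lastʳ ℓ r) (age-lastʳ 1<r)) ⟩
      not (g (pred ℓ)) ∨ g (pred r)          ≡⟨ h0 ⟨
      h 0                                    ≡⟨ cong h age-node₀ ⟨
      h (node-age (node₀ ℓ r))               ∎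
    ... | copy j age≡ upd = begin
      update ℓ r (fromHistory g) i ≡⟨ upd _ ⟩
      lookup (fromHistory g) j     ≡⟨ lookup-fromHistory g j refl ⟩
      g (node-age j)               ≡⟨ hs (node-age j) ⟨
      h (suc (node-age j))         ≡⟨ cong h age≡ ⟨
      h (node-age i)               ∎

  -- The left and right words of a history.

  toList-fromHistory : ∀ g → toList (fromHistory g) ≡ applyUpTo g ℓ ++ applyUpTo (g ∘ suc) (pred r)
  toList-fromHistory g = begin
    toList (fromHistory g)                    ≡⟨ toList-tabulate (g ∘ age) (ℓ + r ∸ 1) ⟩
    applyUpTo (g ∘ age) (ℓ + r ∸ 1)
      ≡⟨ cong (applyUpTo (g ∘ age)) (trans (cong (λ s → ℓ + s ∸ 1) (sym (suc-pred r))) (cong pred (+-suc ℓ (pred r)))) ⟩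
    applyUpTo (g ∘ age) (ℓ + pred r)          ≡⟨ applyUpTo-+ (g ∘ age) ℓ (pred r) ⟩
    applyUpTo (g ∘ age) ℓ ++ applyUpTo (λ j → g (age (ℓ + j))) (pred r)
      ≡⟨ cong₂ _++_ (applyUpTo-cong ℓ (λ j<ℓ → cong g (age-left j<ℓ)))
                    (applyUpTo-cong (pred r) (λ {j} _ → cong g (age-right j))) ⟩
    applyUpTo g ℓ ++ applyUpTo (g ∘ suc) (pred r) ∎

  leftWord-fromHistory : ∀ g → leftWord ℓ r (fromHistory g) ≡ applyUpTo g ℓ
  leftWord-fromHistory g = trans (cong (take ℓ) (toList-fromHistory g)) (take-applyUpTo-++ g ℓ _)

  -- Nodes ℓ, ..., n - 1 have ages 1, ..., r - 1, and the leading node 0 supplies age 0. Hence both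
  -- words are initial segments of the same sequence g.
  rightWord-fromHistory : ∀ g → rightWord ℓ r (fromHistory g) ≡ applyUpTo g r
  rightWord-fromHistory g = begin
    lookup (fromHistory g) (node₀ ℓ r) ∷ drop ℓ (toList (fromHistory g))
      ≡⟨ cong₂ _∷_ (lookup-fromHistory g (node₀ ℓ r) age-node₀)
           (trans (cong (drop ℓ) (toList-fromHistory g)) (drop-applyUpTo-++ g ℓ _)) ⟩
    applyUpTo g (suc (pred r)) ≡⟨ cong (applyUpTo g) (suc-pred r) ⟩
    applyUpTo g r ∎

  words-injective : ∀ {x y} → leftWord ℓ r x ≡ leftWord ℓ r y → rightWord ℓ r x ≡ rightWord ℓ r y → x ≡ y
  words-injective {x} {y} eqˡ eqʳ = trans (sym (cast-is-id refl x))
    (toList-injective refl x y (take-drop-injective ℓ eqˡ (∷-injectiveʳ eqʳ)))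

-- Configurations of period p, with p = suc p′; multiplication by p′ is negation modulo p.

module PeriodicConfigs (ℓ r p′ q k d : ℕ) .{{ℓ≢0 : NonZero ℓ}} .{{r≢0 : NonZero r}}
  (1<r : 1 < r) (d<p : d < suc p′) (r≡p*q : r ≡ suc p′ * q) (ℓ≡k*p+d : ℓ ≡ k * suc p′ + d) where

  open History ℓ r

  p : ℕ
  p = suc p′

  -- Configurations spelled by a word, and their orbits.

  spells-fromHistory : ∀ (w : Word p) → Spells ℓ r k q d w (fromHistory (cycle w))
  spells-fromHistory w = left , right
    where
    g = cycle w
    left : leftWord ℓ r (fromHistory g) ≡ (toList w ^ʷ k) ++ take d (toList w)
    left = begin
      leftWord ℓ r (fromHistory g)           ≡⟨ leftWord-fromHistory g ⟩
      applyUpTo g ℓ                          ≡⟨ cong (applyUpTo g) ℓ≡k*p+d ⟩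
      applyUpTo g (k * p + d)                ≡⟨ applyUpTo-periodic (cycle-periodic w) k d ⟨
      (applyUpTo g p ^ʷ k) ++ applyUpTo g d
        ≡⟨ cong ((applyUpTo g p ^ʷ k) ++_) (take-applyUpTo g (<⇒≤ d<p)) ⟨
      (applyUpTo g p ^ʷ k) ++ take d (applyUpTo g p)
        ≡⟨ cong (λ u → (u ^ʷ k) ++ take d u) (toList-cycle w) ⟨
      (toList w ^ʷ k) ++ take d (toList w)   ∎
    right : rightWord ℓ r (fromHistory g) ≡ toList w ^ʷ q
    right = begin
      rightWord ℓ r (fromHistory g)  ≡⟨ rightWord-fromHistory g ⟩
      applyUpTo g r                  ≡⟨ cong (applyUpTo g) (trans r≡p*q (trans (*-comm p q) (sym (+-identityʳ (q * p))))) ⟩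
      applyUpTo g (q * p + 0)        ≡⟨ applyUpTo-periodic (cycle-periodic w) q 0 ⟨
      (applyUpTo g p ^ʷ q) ++ []     ≡⟨ ++-identityʳ _ ⟩
      applyUpTo g p ^ʷ q             ≡⟨ cong (_^ʷ q) (toList-cycle w) ⟨
      toList w ^ʷ q                  ∎

  spells⇒fromHistory : ∀ {w : Word p} {x} → Spells ℓ r k q d w x → x ≡ fromHistory (cycle w)
  spells⇒fromHistory {w} (left , right) with spells-fromHistory w
  ... | left′ , right′ = words-injective (trans left (sym left′)) (trans right (sym right′))

  -- The word is the first block of x^R; such a block exists because r ≠ 0 forces q ≠ 0.
  spells-unique : ∀ {w v : Word p} {x} → Spells ℓ r k q d w x → Spells ℓ r k q d v x → w ≡ v
  spells-unique {w} {v} (_ , right) (_ , right′) = go q r≡p*q (trans (sym right) right′)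
    where
    go : ∀ q → r ≡ p * q → toList w ^ʷ q ≡ toList v ^ʷ q → w ≡ v
    go zero    r≡p*0 _  = contradiction (trans (suc-pred r) (trans r≡p*0 (*-comm p 0))) 1+n≢0
    go (suc q) _     eq = toList-++-injectiveˡ w v eq

  -- Each step rotates the history: shifting the index by p′ is shifting it by -1 modulo p. The
  -- shifted sequence is again periodic and avoiding, so the induction continues.
  orbit : ∀ {g} → Periodic p g → Avoids d g → ∀ i →
          iterate (F ℓ r) (fromHistory g) i ≡ fromHistory (λ j → g (j + i * p′))
  orbit {g} per av zero    = fromHistory-cong (λ j → cong g (sym (+-identityʳ j)))
  orbit {g} per av (suc i) = begin
    iterate (F ℓ r) (F ℓ r (fromHistory g)) i ≡⟨ cong (λ y → iterate (F ℓ r) y i) (F-fromHistory 1<r {h = h} front shift) ⟩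
    iterate (F ℓ r) (fromHistory h) i         ≡⟨ orbit per-h av-h i ⟩
    fromHistory (λ j → h (j + i * p′))
      ≡⟨ fromHistory-cong (λ j → cong g (trans (+-assoc j (i * p′) p′) (cong (j +_) (+-comm (i * p′) p′)))) ⟩
    fromHistory (λ j → g (j + suc i * p′))    ∎
    where
    h : ℕ → Bool
    h j = g (j + p′)
    swap : ∀ j m → j + m + p′ ≡ j + p′ + m
    swap j m = trans (+-assoc j m p′) (trans (cong (j +_) (+-comm m p′)) (sym (+-assoc j p′ m)))
    per-h : Periodic p h
    per-h j = trans (cong g (swap j p)) (per (j + p′))
    av-h : Avoids d h
    av-h j hⱼ≡0 hⱼ₊d≡0 = av (j + p′) hⱼ≡0 (trans (cong g (sym (swap j d))) hⱼ₊d≡0)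
    exchange : ∀ m n → m + suc n ≡ n + suc m
    exchange m n = trans (+-suc m n) (trans (cong suc (+-comm m n)) (sym (+-suc n m)))
    -- As p′ ≡ -1 and ℓ ≡ d modulo p, both indices are congruent to ℓ - 1; in `g-right`, r ≡ 0 makes
    -- both congruent to -1.
    g-left : g (p′ + d) ≡ g (pred ℓ)
    g-left = periodic-≡ per k 1 (begin
      p′ + d + k * p     ≡⟨ +-assoc p′ d (k * p) ⟩
      p′ + (d + k * p)   ≡⟨ cong (p′ +_) (trans (+-comm d (k * p)) (sym ℓ≡k*p+d)) ⟩
      p′ + ℓ             ≡⟨ cong (p′ +_) (suc-pred ℓ) ⟨
      p′ + suc (pred ℓ)  ≡⟨ exchange p′ (pred ℓ) ⟩
      pred ℓ + p         ≡⟨ cong (pred ℓ +_) (+-identityʳ p) ⟨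
      pred ℓ + 1 * p     ∎)
    g-right : g p′ ≡ g (pred r)
    g-right = periodic-≡ per q 1 (begin
      p′ + q * p         ≡⟨ cong (p′ +_) (trans (*-comm q p) (sym r≡p*q)) ⟩
      p′ + r             ≡⟨ cong (p′ +_) (suc-pred r) ⟨
      p′ + suc (pred r)  ≡⟨ exchange p′ (pred r) ⟩
      pred r + p         ≡⟨ cong (pred r +_) (+-identityʳ p) ⟨
      pred r + 1 * p     ∎)
    front : h 0 ≡ not (g (pred ℓ)) ∨ g (pred r)
    -- Avoidance at index p′ is the update rule of node 0, once its indices are replaced by the ages
    -- of the two last nodes.
    front = trans (avoids⇒fixed av p′) (cong₂ (λ a b → not a ∨ b) g-left g-right)
    shift : ∀ j → h (suc j) ≡ g j
    shift j = trans (cong g (sym (+-suc j p′))) (per j)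

  -- After m p steps the total shift m p p′ is a multiple of p.
  avoids⇒period : ∀ {g} → Periodic p g → Avoids d g → HasPeriod ℓ r p (fromHistory g)
  avoids⇒period {g} per av m = trans (orbit per av (m * p)) (fromHistory-cong λ j → begin
    g (j + m * p * p′)   ≡⟨ cong (λ n → g (j + n)) (trans (*-assoc m p p′) (trans (cong (m *_) (*-comm p p′)) (sym (*-assoc m p′ p)))) ⟩
    g (j + m * p′ * p)   ≡⟨ periodic-* per (m * p′) j ⟩
    g j                  ∎)

  state₀-fromHistory : ∀ {g} → Periodic p g → Avoids d g → ∀ i → state₀ ℓ r (fromHistory g) i ≡ g (i * p′)
  state₀-fromHistory {g} per av i = trans (cong (λ y → lookup y (node₀ ℓ r)) (orbit per av i))
    (lookup-fromHistory (λ j → g (j + i * p′)) (node₀ ℓ r) age-node₀)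

  -- The past of node 0 in a periodic configuration.

  module _ {x : Config ℓ r} (hp : HasPeriod ℓ r p x) where

    iterate-period : ∀ t → HasPeriod ℓ r p (iterate (F ℓ r) x t)
    iterate-period t m = begin
      iterate (F ℓ r) (iterate (F ℓ r) x t) (m * p) ≡⟨ iterate-+ (F ℓ r) x t (m * p) ⟨
      iterate (F ℓ r) x (t + m * p)                 ≡⟨ cong (iterate (F ℓ r) x) (+-comm t (m * p)) ⟩
      iterate (F ℓ r) x (m * p + t)                 ≡⟨ iterate-+ (F ℓ r) x (m * p) t ⟩
      iterate (F ℓ r) (iterate (F ℓ r) x (m * p)) t ≡⟨ cong (λ y → iterate (F ℓ r) y t) (hp m) ⟩
      iterate (F ℓ r) x t                           ∎

    -- Time -j is read off at time j p′, which is congruent to it modulo p, since the trajectory is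
    -- only given forwards.
    past : ℕ → Bool
    past j = state₀ ℓ r x (j * p′)

    state₀-periodic : Periodic p (state₀ ℓ r x)
    state₀-periodic t = begin
      state₀ ℓ r x (t + p)                     ≡⟨ cong (λ n → state₀ ℓ r x (t + n)) (+-identityʳ p) ⟨
      state₀ ℓ r x (t + 1 * p)                 ≡⟨ state₀-+ x t (1 * p) ⟨
      state₀ ℓ r (iterate (F ℓ r) x t) (1 * p) ≡⟨ cong (λ y → lookup y (node₀ ℓ r)) (iterate-period t 1) ⟩
      state₀ ℓ r x t                           ∎

    past-periodic : Periodic p past
    past-periodic j = trans
      (cong (state₀ ℓ r x) (trans (*-distribʳ-+ p′ j p) (cong (j * p′ +_) (*-comm p p′))))
      (periodic-* state₀-periodic p′ (j * p′))

    -- A node of age a shows at time a p what node 0 showed a steps earlier, at time a p′; and at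
    -- time a p the configuration is x again.
    period⇒fromHistory : x ≡ fromHistory past
    period⇒fromHistory = trans (sym (tabulate∘lookup x)) (tabulate-cong λ i → let a = node-age i in begin
      lookup x i                                                ≡⟨ cong (λ y → lookup y i) (hp a) ⟨
      lookup (iterate (F ℓ r) x (a * p)) i
        ≡⟨ cong (λ n → lookup (iterate (F ℓ r) x n) i) (trans (*-suc a p′) (+-comm a (a * p′))) ⟩
      lookup (iterate (F ℓ r) x (a * p′ + a)) i                 ≡⟨ cong (λ y → lookup y i) (iterate-+ (F ℓ r) x (a * p′) a) ⟩
      lookup (iterate (F ℓ r) (iterate (F ℓ r) x (a * p′)) a) i ≡⟨ lookup-delayed _ i ⟩
      past a                                                    ∎)

  -- Both inputs of node 0 at time t are earlier states of node 0 itself, of ages ℓ - 1 and r - 1,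
  -- because every configuration of the orbit is given by its own past.
  state₀-rule : ∀ {x} → HasPeriod ℓ r p x → ∀ t →
    state₀ ℓ r x (suc t) ≡ not (state₀ ℓ r x (t + pred ℓ * p′)) ∨ state₀ ℓ r x (t + pred r * p′)
  state₀-rule {x} hp t = begin
    state₀ ℓ r x (suc t)                                     ≡⟨ state₀-suc x t ⟩
    lookup (F ℓ r y) (node₀ ℓ r)                             ≡⟨ update-node₀ y ⟩
    not (lookup y (lastˡ ℓ r)) ∨ lookup y (lastʳ ℓ r)
      ≡⟨ cong₂ (λ a b → not a ∨ b) (carried (lastˡ ℓ r) age-lastˡ) (carried (lastʳ ℓ r) (age-lastʳ 1<r)) ⟩
    not (state₀ ℓ r x (t + pred ℓ * p′)) ∨ state₀ ℓ r x (t + pred r * p′) ∎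
    where
    y = iterate (F ℓ r) x t
    hp-y = iterate-period hp t
    carried : ∀ i {a} → node-age i ≡ a → lookup y i ≡ state₀ ℓ r x (t + a * p′)
    carried i {a} age≡a = begin
      lookup y i                           ≡⟨ cong (λ z → lookup z i) (period⇒fromHistory hp-y) ⟩
      lookup (fromHistory (past hp-y)) i   ≡⟨ lookup-fromHistory (past hp-y) i age≡a ⟩
      state₀ ℓ r y (a * p′)                ≡⟨ state₀-+ x t (a * p′) ⟩
      state₀ ℓ r x (t + a * p′)            ∎

  -- The rule of node 0 at time t + 1 with t = (j + 1) p′, that is, t + 1 ≡ − j modulo p.
  past-avoids : ∀ {x} (hp : HasPeriod ℓ r p x) → Avoids d (past hp)
  past-avoids {x} hp = fixed⇒avoids λ j → begin
    g j                                 ≡⟨ state₀-periodic hp (j * p′) ⟨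
    s (j * p′ + p)                      ≡⟨ cong s (trans (+-suc (j * p′) p′) (cong suc (+-comm (j * p′) p′))) ⟩
    s (suc (suc j * p′))                ≡⟨ state₀-rule hp (suc j * p′) ⟩
    not (s (suc j * p′ + pred ℓ * p′)) ∨ s (suc j * p′ + pred r * p′)
      ≡⟨ cong₂ (λ a b → not a ∨ b) (merge j ℓ) (merge j r) ⟩
    not (g (j + ℓ)) ∨ g (j + r)         ≡⟨ cong₂ (λ a b → not a ∨ b) (g-left j) (g-right j) ⟩
    not (g (j + d)) ∨ g j               ∎
    where
    s = state₀ ℓ r x
    g = past hp
    merge : ∀ j n .{{_ : NonZero n}} → s (suc j * p′ + pred n * p′) ≡ g (j + n)
    merge j n = cong s (begin
      suc j * p′ + pred n * p′   ≡⟨ *-distribʳ-+ p′ (suc j) (pred n) ⟨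
      (suc j + pred n) * p′      ≡⟨ cong (_* p′) (trans (sym (+-suc j (pred n))) (cong (j +_) (suc-pred n))) ⟩
      (j + n) * p′               ∎)
    g-left : ∀ j → g (j + ℓ) ≡ g (j + d)
    g-left j = begin
      g (j + ℓ)             ≡⟨ cong (λ n → g (j + n)) (trans ℓ≡k*p+d (+-comm (k * p) d)) ⟩
      g (j + (d + k * p))   ≡⟨ cong g (+-assoc j d (k * p)) ⟨
      g (j + d + k * p)     ≡⟨ periodic-* (past-periodic hp) k (j + d) ⟩
      g (j + d)             ∎
    g-right : ∀ j → g (j + r) ≡ g j
    g-right j = trans (cong (λ n → g (j + n)) (trans r≡p*q (*-comm p q))) (periodic-* (past-periodic hp) q j)

  -- From periods to words and back.

  period⇒word : ∀ {x} → HasPeriod ℓ r p x → ∃ λ (w : Word p) → ¬ Contains0u0 d w × Spells ℓ r k q d w x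
  period⇒word {x} hp = w , avoids⇒¬contains w av , subst (Spells ℓ r k q d w) x≡ (spells-fromHistory w)
    where
    w : Word p
    -- The word lists the states of node 0 backwards in time over one period.
    w = onePeriod (past hp)
    w≗past : ∀ j → cycle w j ≡ past hp j
    w≗past = cycle-onePeriod (past-periodic hp)
    av : Avoids d (cycle w)
    av j wⱼ≡0 wⱼ₊d≡0 = past-avoids hp j (trans (sym (w≗past j)) wⱼ≡0) (trans (sym (w≗past (j + d))) wⱼ₊d≡0)
    x≡ : fromHistory (cycle w) ≡ x
    x≡ = trans (fromHistory-cong w≗past) (sym (period⇒fromHistory hp))

  -- The period yields some avoiding word that spells x; by uniqueness it is the given one.
  period⇒¬contains : ∀ {w : Word p} {x} → Spells ℓ r k q d w x → HasPeriod ℓ r p x → ¬ Contains0u0 d w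
  period⇒¬contains sp hp with period⇒word hp
  ... | v , nc , sp′ = subst (¬_ ∘ Contains0u0 d) (spells-unique sp′ sp) nc

  word⇒period : ∀ {w : Word p} {x} → ¬ Contains0u0 d w → Spells ℓ r k q d w x → HasPeriod ℓ r p x
  word⇒period {w} nc sp = subst (HasPeriod ℓ r p) (sym (spells⇒fromHistory sp))
    (avoids⇒period (cycle-periodic w) (¬contains⇒avoids w nc))

  state₀-word : ∀ {w : Word p} {x} → ¬ Contains0u0 d w → Spells ℓ r k q d w x → ∀ i → state₀ ℓ r x i ≡ cycle w (i * p′)
  state₀-word {w} nc sp i = trans (cong (λ y → state₀ ℓ r y i) (spells⇒fromHistory sp))
    (state₀-fromHistory (cycle-periodic w) (¬contains⇒avoids w nc) i)

  word⇒traces : ∀ {w : Word p} {x} → ¬ Contains0u0 d w → Spells ℓ r k q d w x → TracesNode₀ ℓ r w x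
  -- Both p - n and n p′ are congruent to -n modulo p.
  word⇒traces {w} {x} nc sp i = trans (periodic-≡ (cycle-periodic w) n 1 (begin
    p ∸ n + n * p          ≡⟨ cong (p ∸ n +_) (*-suc n p′) ⟩
    p ∸ n + (n + n * p′)   ≡⟨ +-assoc (p ∸ n) n (n * p′) ⟨
    p ∸ n + n + n * p′     ≡⟨ cong (_+ n * p′) (m∸n+n≡m (<⇒≤ (toℕ<n i))) ⟩
    p + n * p′             ≡⟨ +-comm p (n * p′) ⟩
    n * p′ + p             ≡⟨ cong (n * p′ +_) (+-identityʳ p) ⟨
    n * p′ + 1 * p         ∎)) (sym (state₀-word nc sp n))
    where n = toℕ i

-- The equivalence, and its independence of ℓ and r.

proposition2 : (ℓ r p q k d : ℕ) .{{_ : NonZero ℓ}} .{{_ : NonZero r}} .{{_ : NonZero p}} →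
    r ≡ p * q → ¬ (p ∣ ℓ) → d ≡ ℓ % p → ℓ ≡ k * p + d →
    ((x : Config ℓ r) →
    (HasPeriod ℓ r p x ⇔ (∃ λ (w : Word p) → ¬ Contains0u0 d w × Spells ℓ r k q d w x))
    × ((w : Word p) → ¬ Contains0u0 d w → Spells ℓ r k q d w x → TracesNode₀ ℓ r w x))
    × ((ℓ′ r′ q′ k′ : ℕ) .{{_ : NonZero ℓ′}} .{{_ : NonZero r′}} →
    r′ ≡ p * q′ → d ≡ ℓ′ % p → ℓ′ ≡ k′ * p + d →
    ((w : Word p) (x : Config ℓ r) (x′ : Config ℓ′ r′) →
    Spells ℓ r k q d w x → Spells ℓ′ r′ k′ q′ d w x′ →
    (HasPeriod ℓ r p x ⇔ HasPeriod ℓ′ r′ p x′))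
    × ((x : Config ℓ r) → HasPeriod ℓ r p x →
    ∃ λ (x′ : Config ℓ′ r′) → HasPeriod ℓ′ r′ p x′
    × ((i : ℕ) → state₀ ℓ r x i ≡ state₀ ℓ′ r′ x′ i)))
-- As 1 divides every ℓ, only p ≥ 2 remains; then r, a nonzero multiple of p, exceeds 1.
proposition2 ℓ r (suc zero) q k d r≡ p∤ℓ d≡ ℓ≡ = contradiction (1∣ ℓ) p∤ℓ
proposition2 ℓ r (suc p′@(suc _)) q k d r≡ p∤ℓ d≡ ℓ≡ =
  (λ x → mk⇔ D.period⇒word (λ (w , nc , sp) → D.word⇒period nc sp) , λ w → D.word⇒traces) ,
  λ ℓ′ r′ q′ k′ r′≡ _ ℓ′≡ →
    let module D′ = PeriodicConfigs ℓ′ r′ p′ q′ k′ d (1<multiple q′ r′≡) d<p r′≡ ℓ′≡ in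
    -- Avoidance mentions only w and d, so the period passes through it from one circuit to the
    -- other.
    (λ w x x′ sp sp′ → mk⇔ (λ hp → D′.word⇒period (D.period⇒¬contains sp hp) sp′)
                           (λ hp → D.word⇒period (D′.period⇒¬contains sp′ hp) sp)) ,
    -- The word of x is spelled out in the second circuit; at time i node 0 then shows the letter at
    -- index i p′ of the same circular word in both circuits.
    λ x hp → let (w , nc , sp) = D.period⇒word hp
                 sp′ = D′.spells-fromHistory w
             in History.fromHistory ℓ′ r′ (cycle w) , D′.word⇒period nc sp′ ,
                λ i → trans (D.state₀-word nc sp i) (sym (D′.state₀-word nc sp′ i))
  where
  p = suc p′
  d<p : d < p
  d<p = subst (_< p) (sym d≡) (m%n<n ℓ p)
  1<multiple : ∀ {s} m .{{_ : NonZero s}} → s ≡ p * m → 1 < s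
  1<multiple m s≡ = ≤-trans (s≤s (s≤s z≤n)) (∣⇒≤ (subst (p ∣_) (sym s≡) (m∣m*n m)))
  module D = PeriodicConfigs ℓ r p′ q k d (1<multiple q r≡) d<p r≡ ℓ≡
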